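{- Let $1\le t\le k$ be integers and let $a_1,b_1,s_2,\dots,s_k,N_1,N_2$ be positive integers with $\frac{N_1}{a_1}=\frac{N_2}{b_1}$. If there exist an $\mathrm{OA}(N_1,a_1s_2\cdots s_k,t)$ and an $\mathrm{OA}(N_2,b_1s_2\cdots s_k,t)$, then there exists an optimal $$\mathrm{NOA}\bigl((N_1+N_2,N_1),\,k,\,((a_1+b_1)s_2\cdots s_k,\ a_1s_2\cdots s_k),\,t\bigr).$$
   Context: For a positive integer $s$, $\mathbb{Z}_s=\{0,1,\dots,s-1\}$. Arrays are nonempty finite multisets of rows; $|A|$ counts rows with multiplicity. Let $G=\mathbb{Z}_{s_1}\times\cdots\times\mathbb{Z}_{s_k}$; for $I=\{i_1,\dots,i_t\}\subseteq\{1,\dots,k\}$ let $G_I=\mathbb{Z}_{s_{i_1}}\times\cdots\times\mathbb{Z}_{s_{i_t}}$ and let $\pi_I:G\to G_I$ be the coordinate projection. For $1\le t\le k$, a finite multiset $A$ of elements of $G$ is an orthogonal array of strength $t$ over $G$, denoted $\mathrm{OA}(|A|,s_1s_2\cdots s_k,t)$, if for every $I$ with $|I|=t$ there is a positive integer $\lambda_I$ with $|\{\alpha\in A:\pi_I(\alpha)=\beta\}|=\lambda_I$ for all $\beta\in G_I$ (counted with multiplicity). In this notation $s_1s_2\cdots s_k$ is the list of numbers of levels of the $k$ factors, not a product; $(a_1+b_1)s_2\cdots s_k$ means that the first factor has $a_1+b_1$ levels and factor $i\ge2$ has $s_i$ levels. Nested orthogonal array: let $S_i\ge R_i$ be positive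 integers for $1\le i\le k$, with strict inequality for at least one $i$. An $\mathrm{NOA}((N,M),k,(S_1S_2\cdots S_k,R_1R_2\cdots R_k),t)$ is an $\mathrm{OA}(N,S_1\cdots S_k,t)$, $A$, over $\mathbb{Z}_{S_1}\times\cdots\times\mathbb{Z}_{S_k}$ that contains a subarray (sub-multiset of rows) $B$ whose rows lie in $\prod_i\{0,\dots,R_i-1\}$ and which is an $\mathrm{OA}(M,R_1\cdots R_k,t)$ over $\mathbb{Z}_{R_1}\times\cdots\times\mathbb{Z}_{R_k}$. Optimality: with the factors indexed so that $\frac{S_1}{R_1}=\max_i\frac{S_i}{R_i}$ (which holds for the array in the claim), such an NOA is called optimal if $N$ equals $$M\sum_{i=0}^{t/2}\sum_{\substack{I\subseteq\{1,\dots,k\}\\|I|=i}}\prod_{j\in I}\Bigl(\frac{S_j}{R_j}-1\Bigr)\quad\text{when } t \text{ is even},$$ $$M\left[\sum_{i=0}^{\lfloor t/2\rfloor}\sum_{\substack{I\subseteq\{1,\dots,k\}\\|I|=i}}\prod_{j\in I}\Bigl(\frac{S_j}{R_j}-1\Bigr)+\Bigl(\frac{S_1}{R_1}-1\Bigr)\sum_{\substack{I\subseteq\{2,\dots,k\}\\|I|=\lfloor t/2\rfloor}}\prod_{j\in I}\Bigl(\frac{S_j}{R_j}-1\Bigr)\right]\quad\text{when } t\text{ is odd}.$$ Empty products equal $1$. -}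

module Defs where

open import Data.Bool.Base using (if_then_else_)
open import Data.Fin.Base using (Fin; zero; suc; inject≤)
import Data.Fin.Properties as Fin
open import Data.Fin.Subset using (Subset; inside; outside; ∣_∣)
open import Data.Fin.Subset.Properties using (_∈?_)
open import Data.Integer.Base using (+_)
open import Data.List.Base using (List; []; _∷_; _++_; map; filter; foldr; length; allFin; upTo)
open import Data.List.Relation.Binary.BagAndSetEquality using (_∼[_]_; subbag)
open import Data.Nat.Base as ℕ using (ℕ; zero; suc; NonZero; ⌊_/2⌋)
import Data.Nat.Properties as ℕ
open import Data.Nat.Divisibility using (_∣?_)
open import Data.Product.Base using (_×_; ∃; ∃-syntax; _,_; uncurry)
open import Data.Rational.Base as ℚ using (ℚ; 0ℚ; 1ℚ; _/_; _+_; _-_; _*_)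
open import Data.Vec.Base as Vec using (Vec; []; _∷_; lookup)
open import Data.Vec.Membership.Propositional.Properties using (∈-lookup)
open import Data.Vec.Relation.Binary.Pointwise.Inductive using (Pointwise; []; _∷_)
open import Data.Vec.Relation.Unary.All as All using (All; []; _∷_)
open import Function.Base using (_∘_)
open import Relation.Binary.Definitions using (DecidableEquality)
open import Relation.Binary.PropositionalEquality using (_≡_; refl; cong₂)
open import Relation.Nullary.Decidable using (does; yes; no; map′; _×-dec_)

private
  variable
    k : ℕ

-- The product ℤ_{s₁} × ⋯ × ℤ_{s_k}.  It is first-order data, so that _≡_ on
-- rows is the intended equality.
Row : Vec ℕ k → Set
Row = All Fin

_≟ʳ_ : {s : Vec ℕ k} → DecidableEquality (Row s)
[]      ≟ʳ []      = yes refl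
(x ∷ α) ≟ʳ (y ∷ β) =
  map′ (uncurry (cong₂ _∷_)) (λ { refl → refl , refl }) ((x Fin.≟ y) ×-dec (α ≟ʳ β))

restrict : (I : Subset k) → Vec ℕ k → Vec ℕ ∣ I ∣
restrict []            []      = []
restrict (inside  ∷ I) (x ∷ s) = x ∷ restrict I s
restrict (outside ∷ I) (x ∷ s) = restrict I s

π : (I : Subset k) {s : Vec ℕ k} → Row s → Row (restrict I s)
π []            []      = []
π (inside  ∷ I) (x ∷ α) = x ∷ π I α
π (outside ∷ I) (x ∷ α) = π I α

-- Multisets of rows are lists; no notion below depends on the order of the list.
multiplicity : {s : Vec ℕ k} (A : List (Row s)) (I : Subset k) → Row (restrict I s) → ℕ
multiplicity A I β = length (filter (λ α → π I α ≟ʳ β) A)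

record IsOA {k : ℕ} (N : ℕ) (s : Vec ℕ k) (t : ℕ) (A : List (Row s)) : Set where
  field
    1≤t      : 1 ℕ.≤ t
    t≤k      : t ℕ.≤ k
    levels≢0 : All NonZero s
    N≢0      : NonZero N
    size     : length A ≡ N
    balanced : (I : Subset k) → ∣ I ∣ ≡ t →
               ∃[ l ] NonZero l × (∀ β → multiplicity A I β ≡ l)

embed : {R S : Vec ℕ k} → Pointwise ℕ._≤_ R S → Row R → Row S
embed []            []      = []
embed (r≤s ∷ R≤S) (x ∷ α) = inject≤ x r≤s ∷ embed R≤S α

record NOA (N M k : ℕ) (S R : Vec ℕ k) (t : ℕ) : Set where
  field
    R≤S         : Pointwise ℕ._≤_ R S
    R<S         : ∃[ i ] lookup R i ℕ.< lookup S i
    outer       : List (Row S)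
    inner       : List (Row R)
    outer-isOA  : IsOA N S t outer
    inner-isOA  : IsOA M R t inner
    inner⊆outer : map (embed R≤S) inner ∼[ subbag ] outer

  R≢0 : All NonZero R
  R≢0 = IsOA.levels≢0 inner-isOA

subsets : ∀ n → List (Subset n)
subsets zero    = [] ∷ []
subsets (suc n) = map (outside ∷_) (subsets n) ++ map (inside ∷_) (subsets n)

∑ : {X : Set} → List X → (X → ℚ) → ℚ
∑ xs f = foldr _+_ 0ℚ (map f xs)

∏ : {X : Set} → List X → (X → ℚ) → ℚ
∏ xs f = foldr _*_ 1ℚ (map f xs)

-- ∑_{I ⊆ {1,…,n}, |I| = i} ∏_{j ∈ I} x_j
∑∏ : ∀ {n} → ℕ → (Fin n → ℚ) → ℚ
∑∏ {n} i x = ∑ (filter (λ I → ∣ I ∣ ℕ.≟ i) (subsets n))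
               (λ I → ∏ (filter (_∈? I) (allFin n)) x)

ratio : (S R : Vec ℕ k) → All NonZero R → Fin k → ℚ
ratio S R R≢0 j = _/_ (+ lookup S j) (lookup R j) {{All.lookup R≢0 (∈-lookup j R)}}

-- The factor of M in the size of an optimal array, where x_j = S_j / R_j - 1.
-- Since upTo m is 0, …, m - 1, the first sum is over 0 ≤ i ≤ ⌊t/2⌋.  The
-- last sum, which ranges over subsets of {2,…,k}, sees x only through suc.
boundFactor : ∀ {n} → ℕ → (Fin (suc n) → ℚ) → ℚ
boundFactor t x =
  if does (2 ∣? t)
  then low
  else low + x zero * ∑∏ ⌊ t /2⌋ (x ∘ suc)
  where
  low : ℚ
  low = ∑ (upTo (suc ⌊ t /2⌋)) (λ i → ∑∏ i x)

-- Optimality is relative to an indexing of the factors in which the first one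
-- has the largest ratio S_j / R_j; this is the first field.
record Optimal {N M n t : ℕ} {S R : Vec ℕ (suc n)} (P : NOA N M (suc n) S R t) : Set where
  ρ : Fin (suc n) → ℚ
  ρ = ratio S R (NOA.R≢0 P)

  field
    first-max : ∀ j → ρ j ℚ.≤ ρ zero
    size      : + N / 1 ≡ (+ M / 1) * boundFactor t (λ j → ρ j - 1ℚ)

{-# OPTIONS --safe #-}
-- Stack the two arrays, raising the first coordinate of every row of the second
-- by a₁.  A projection that keeps the first factor sees one of the arrays only,
-- and counting rows shows that both have the same index there because
-- N₁ / a₁ = N₂ / b₁; a projection that forgets it sees both, and the indices add up.
-- For optimality, x₁ = b₁ / a₁ and x_j = 0 for j ≥ 2, so all elementary symmetric
-- sums beyond 1 and x₁ vanish and the bound is N₁ (1 + b₁ / a₁) = N₁ + N₂.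
module Submission where

open import Defs
open import Data.Bool.Base using (Bool; true; false; _∧_; if_then_else_)
open import Data.Fin.Base using (Fin; zero; suc; splitAt; _↑ˡ_; _↑ʳ_)
import Data.Fin.Properties as Fin
open import Data.Fin.Subset using (Subset; inside; outside; ∣_∣)
open import Data.Fin.Subset.Properties using (_∈?_)
open import Data.Integer.Base as ℤ using (+_)
import Data.Integer.Properties as ℤ
open import Data.List.Base using (List; []; _∷_; _++_; map; filter; foldr; length; allFin; tabulate; upTo; applyUpTo)
import Data.List.Properties as List
open import Data.List.Relation.Binary.BagAndSetEquality using (_∼[_]_; subbag)
import Data.List.Relation.Unary.All as ListAll
import Data.List.Relation.Unary.All.Properties as ListAll
open import Data.List.Relation.Unary.Any.Properties using (++↔)
open import Data.Nat.Base using (ℕ; zero; suc; _+_; _*_; _≤_; NonZero; 2+; >-nonZero⁻¹; ⌊_/2⌋)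
import Data.Nat.Properties as ℕ
open import Data.Nat.Divisibility using (_∣?_)
open import Algebra.Properties.CommutativeMonoid.Sum ℕ.+-0-commutativeMonoid
  using (sum; ∑-distrib-+; sum-cong-≗)
open import Data.Product.Base using (∃; ∃-syntax; _×_; _,_)
open import Data.Rational.Base as ℚ using (ℚ; 0ℚ; 1ℚ; _/_; toℚᵘ)
import Data.Rational.Properties as ℚ
open import Data.Rational.Unnormalised.Base as ℚᵘ using (mkℚᵘ; *≡*; *≤*)
import Data.Rational.Unnormalised.Properties as ℚᵘ
open import Data.Sum.Base using (inj₁; inj₂)
open import Data.Sum.Properties using (inj₁-injective)
open import Data.Vec.Base as Vec using (Vec; []; _∷_; lookup)
open import Data.Vec.Membership.Propositional.Properties using (∈-lookup)
open import Data.Vec.Relation.Binary.Pointwise.Inductive as Pointwise using (Pointwise; []; _∷_)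
open import Data.Vec.Relation.Unary.All as All using (All; []; _∷_)
open import Level using (0ℓ)
open import Function.Base using (_∘_; id)
open import Function.Bundles using (mk↣; mk⇔)
open import Function.Construct.Composition using (_↣-∘_)
open import Function.Definitions using (Injective)
open import Function.Properties.Inverse using (↔⇒↣)
open import Relation.Binary.PropositionalEquality
  using (_≡_; _≢_; refl; sym; trans; cong; cong₂; subst; module ≡-Reasoning)
open import Relation.Nullary.Decidable using (does; dec-false; does-⇔)
open import Relation.Unary using (Pred; Decidable)

private
  variable
    k m n t : ℕ
    s : Vec ℕ k
    X Y : Set

-- Counting rows

indicator : Bool → ℕ
indicator b = if b then 1 else 0

sumRow : (s : Vec ℕ k) → (Row s → ℕ) → ℕ
sumRow []      f = f []
sumRow (m ∷ s) f = sum {m} (λ x → sumRow s (λ α → f (x ∷ α)))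

volume : Vec ℕ k → ℕ
volume = Vec.foldr′ _*_ 1

sum-const : ∀ n c → sum {n} (λ _ → c) ≡ n * c
sum-const zero    c = refl
sum-const (suc n) c = cong (_+_ c) (sum-const n c)

sum-indicator : (x : Fin n) → sum (λ y → indicator (does (x Fin.≟ y))) ≡ 1
sum-indicator {suc n} zero    = cong suc (trans (sum-const n 0) (ℕ.*-zeroʳ n))
sum-indicator {suc n} (suc x) = sum-indicator x

sumRow-cong : (s : Vec ℕ k) {f g : Row s → ℕ} → (∀ α → f α ≡ g α) → sumRow s f ≡ sumRow s g
sumRow-cong []      f≗g = f≗g []
sumRow-cong (m ∷ s) f≗g = sum-cong-≗ (λ x → sumRow-cong s (λ α → f≗g (x ∷ α)))

sumRow-+ : (s : Vec ℕ k) (f g : Row s → ℕ) →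
           sumRow s (λ α → f α + g α) ≡ sumRow s f + sumRow s g
sumRow-+ []      f g = refl
sumRow-+ (m ∷ s) f g = trans
  (sum-cong-≗ (λ x → sumRow-+ s (f ∘ (x ∷_)) (g ∘ (x ∷_))))
  (∑-distrib-+ (λ x → sumRow s (f ∘ (x ∷_))) (λ x → sumRow s (g ∘ (x ∷_))))

sumRow-const : (s : Vec ℕ k) (c : ℕ) → sumRow s (λ _ → c) ≡ volume s * c
sumRow-const []      c = sym (ℕ.*-identityˡ c)
sumRow-const (m ∷ s) c = begin
  sum {m} (λ _ → sumRow s (λ _ → c)) ≡⟨ sum-const m _ ⟩
  m * sumRow s (λ _ → c)             ≡⟨ cong (m *_) (sumRow-const s c) ⟩
  m * (volume s * c)                 ≡⟨ ℕ.*-assoc m (volume s) c ⟨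
  m * volume s * c                   ∎
  where open ≡-Reasoning

-- Only the slice with the same first coordinate as the given row contributes, and by induction it
-- contributes 1.
sumRow-indicator : {s : Vec ℕ k} (α : Row s) →
                   sumRow s (λ β → indicator (does (α ≟ʳ β))) ≡ 1
sumRow-indicator []      = refl
sumRow-indicator {s = m ∷ s} (x ∷ α) =
  trans (sum-cong-≗ (λ y → slice (does (x Fin.≟ y)))) (sum-indicator x)
  where
  -- Equality of rows decides to a conjunction, so its first conjunct, constant on the slice, can be
  -- generalised to any `b`.
  slice : ∀ b → sumRow s (λ β → indicator (b ∧ does (α ≟ʳ β))) ≡ indicator b
  slice true  = sumRow-indicator α
  slice false = trans (sumRow-const s 0) (ℕ.*-zeroʳ (volume s))

multiplicity-∷ : (α : Row s) (A : List (Row s)) (I : Subset k) (β : Row (restrict I s)) →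
  multiplicity (α ∷ A) I β ≡ indicator (does (π I α ≟ʳ β)) + multiplicity A I β
multiplicity-∷ α A I β with does (π I α ≟ʳ β)
... | true  = refl
... | false = refl

multiplicity-++ : (A B : List (Row s)) (I : Subset k) (β : Row (restrict I s)) →
  multiplicity (A ++ B) I β ≡ multiplicity A I β + multiplicity B I β
multiplicity-++ A B I β = trans
  (cong length (List.filter-++ (λ α → π I α ≟ʳ β) A B))
  (List.length-++ (filter (λ α → π I α ≟ʳ β) A))

-- Double counting: each row of `A` has exactly one projection, so it is counted at exactly one `β`.
sumRow-multiplicity : (A : List (Row s)) (I : Subset k) →
  sumRow (restrict I s) (multiplicity A I) ≡ length A
sumRow-multiplicity {s = s} [] I =
  trans (sumRow-const (restrict I s) 0) (ℕ.*-zeroʳ (volume (restrict I s)))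
sumRow-multiplicity {s = s} (α ∷ A) I = begin
  sumRow sᴵ (multiplicity (α ∷ A) I)
    ≡⟨ sumRow-cong sᴵ (multiplicity-∷ α A I) ⟩
  sumRow sᴵ (λ β → indicator (does (π I α ≟ʳ β)) + multiplicity A I β)
    ≡⟨ sumRow-+ sᴵ _ _ ⟩
  sumRow sᴵ (λ β → indicator (does (π I α ≟ʳ β))) + sumRow sᴵ (multiplicity A I)
    ≡⟨ cong₂ _+_ (sumRow-indicator (π I α)) (sumRow-multiplicity A I) ⟩
  suc (length A) ∎
  where
  open ≡-Reasoning
  sᴵ = restrict I s

-- Determines the index from the size of the array, which makes the indices of two arrays
-- comparable.
volume*index≡size : (A : List (Row s)) (I : Subset k) {l : ℕ} →
  (∀ β → multiplicity A I β ≡ l) → volume (restrict I s) * l ≡ length A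
volume*index≡size {s = s} A I {l} balanced = begin
  volume (restrict I s) * l                ≡⟨ sumRow-const (restrict I s) l ⟨
  sumRow (restrict I s) (λ _ → l)          ≡⟨ sumRow-cong (restrict I s) balanced ⟨
  sumRow (restrict I s) (multiplicity A I) ≡⟨ sumRow-multiplicity A I ⟩
  length A                                 ∎
  where open ≡-Reasoning

-- Stacking two arrays

reindex : (Fin m → Fin n) → Row (m ∷ s) → Row (n ∷ s)
reindex f (x ∷ α) = f x ∷ α

module _ {s : Vec ℕ k} (f : Fin m → Fin n) (I : Subset k) where

  multiplicity-reindex-outside : (A : List (Row (m ∷ s))) (β : Row (restrict I s)) →
    multiplicity (map (reindex f) A) (outside ∷ I) β ≡ multiplicity A (outside ∷ I) β
  multiplicity-reindex-outside []            β = refl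
  multiplicity-reindex-outside ((z ∷ α) ∷ A) β
    rewrite multiplicity-∷ (f z ∷ α) (map (reindex f) A) (outside ∷ I) β
          | multiplicity-∷ (z ∷ α) A (outside ∷ I) β =
    cong (_+_ _) (multiplicity-reindex-outside A β)

  -- By injectivity `f z ≡ f x` and `z ≡ x` are equivalent, so every row contributes the same
  -- indicator to both counts.
  multiplicity-reindex-image : Injective _≡_ _≡_ f →
    (A : List (Row (m ∷ s))) (x : Fin m) (β : Row (restrict I s)) →
    multiplicity (map (reindex f) A) (inside ∷ I) (f x ∷ β) ≡ multiplicity A (inside ∷ I) (x ∷ β)
  multiplicity-reindex-image inj []            x β = refl
  multiplicity-reindex-image inj ((z ∷ α) ∷ A) x β
    rewrite multiplicity-∷ (f z ∷ α) (map (reindex f) A) (inside ∷ I) (f x ∷ β)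
          | multiplicity-∷ (z ∷ α) A (inside ∷ I) (x ∷ β) =
    cong₂ _+_
      (cong (λ b → indicator (b ∧ does (π I α ≟ʳ β)))
            (does-⇔ (mk⇔ inj (cong f)) (f z Fin.≟ f x) (z Fin.≟ x)))
      (multiplicity-reindex-image inj A x β)

  multiplicity-reindex-∉image : (A : List (Row (m ∷ s))) {y : Fin n} (β : Row (restrict I s)) →
    (∀ x → f x ≢ y) → multiplicity (map (reindex f) A) (inside ∷ I) (y ∷ β) ≡ 0
  multiplicity-reindex-∉image []            β f≢y = refl
  multiplicity-reindex-∉image ((z ∷ α) ∷ A) {y} β f≢y
    rewrite multiplicity-∷ (f z ∷ α) (map (reindex f) A) (inside ∷ I) (y ∷ β)
          | dec-false (f z Fin.≟ y) (f≢y z) =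
    multiplicity-reindex-∉image A β f≢y

↑ˡ≢↑ʳ : (x : Fin m) (y : Fin n) → x ↑ˡ n ≢ m ↑ʳ y
↑ˡ≢↑ʳ zero    y ()
↑ˡ≢↑ʳ (suc x) y eq = ↑ˡ≢↑ʳ x y (Fin.suc-injective eq)

stack : List (Row (m ∷ s)) → List (Row (n ∷ s)) → List (Row ((m + n) ∷ s))
stack {m = m} {n = n} A B = map (reindex (_↑ˡ n)) A ++ map (reindex (m ↑ʳ_)) B

-- The hypothesis `M * n ≡ N * m` is M/m = N/n with denominators cleared.
stack-isOA : ∀ {M N} {s : Vec ℕ k} {A : List (Row (m ∷ s))} {B : List (Row (n ∷ s))} →
  M * n ≡ N * m → IsOA M (m ∷ s) t A → IsOA N (n ∷ s) t B → IsOA (M + N) ((m + n) ∷ s) t (stack A B)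
stack-isOA {m = m} {n = n} {t = t} {M} {N} {s} {A} {B} Mn≡Nm oaA oaB
  with IsOA.levels≢0 oaA | IsOA.levels≢0 oaB
... | m≢0 ∷ s≢0 | n≢0 ∷ _ = record
  { 1≤t      = IsOA.1≤t oaA
  ; t≤k      = IsOA.t≤k oaA
  ; levels≢0 = m+n≢0 m n {{m≢0}} ∷ s≢0
  ; N≢0      = m+n≢0 M N {{IsOA.N≢0 oaA}}
  ; size     = begin
      length (stack A B)
        ≡⟨ List.length-++ (map (reindex (_↑ˡ n)) A) ⟩
      length (map (reindex (_↑ˡ n)) A) + length (map (reindex (m ↑ʳ_)) B)
        ≡⟨ cong₂ _+_ (List.length-map _ A) (List.length-map _ B) ⟩
      length A + length B
        ≡⟨ cong₂ _+_ (IsOA.size oaA) (IsOA.size oaB) ⟩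
      M + N ∎
  ; balanced = balanced
  }
  where
  open ≡-Reasoning

  m+n≢0 : ∀ m n .{{_ : NonZero m}} → NonZero (m + n)
  m+n≢0 (suc m) n = _

  -- With v the volume of the kept factors after the first, double counting gives M = m v l and N =
  -- n v l′. Substituting in M n = N m yields m n v l = m n v l′, and the common factor cancels.
  indices-agree : (I : Subset _) {l l′ : ℕ} →
    (∀ β → multiplicity A (inside ∷ I) β ≡ l) →
    (∀ β → multiplicity B (inside ∷ I) β ≡ l′) → l ≡ l′
  indices-agree I {l} {l′} bA bB = ℕ.*-cancelˡ-≡ l l′ (n * (m * v)) {{c≢0}} (begin
    n * (m * v) * l     ≡⟨ ℕ.*-assoc n (m * v) l ⟩
    n * (m * v * l)     ≡⟨ cong (n *_) mvl≡M ⟩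
    n * M               ≡⟨ ℕ.*-comm n M ⟩
    M * n               ≡⟨ Mn≡Nm ⟩
    N * m               ≡⟨ cong (_* m) nvl′≡N ⟨
    n * v * l′ * m      ≡⟨ ℕ.*-comm (n * v * l′) m ⟩
    m * (n * v * l′)    ≡⟨ ℕ.*-assoc m (n * v) l′ ⟨
    m * (n * v) * l′    ≡⟨ cong (_* l′) (ℕ.*-assoc m n v) ⟨
    m * n * v * l′      ≡⟨ cong (λ p → p * v * l′) (ℕ.*-comm m n) ⟩
    n * m * v * l′      ≡⟨ cong (_* l′) (ℕ.*-assoc n m v) ⟩
    n * (m * v) * l′    ∎)
    where
    v = volume (restrict I s)

    mvl≡M : m * v * l ≡ M
    mvl≡M = trans (volume*index≡size A (inside ∷ I) bA) (IsOA.size oaA)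

    nvl′≡N : n * v * l′ ≡ N
    nvl′≡N = trans (volume*index≡size B (inside ∷ I) bB) (IsOA.size oaB)

    -- The factor `m * v` is nonzero because its multiple `m * v * l` is the nonzero size `M`.
    c≢0 : NonZero (n * (m * v))
    c≢0 = ℕ.m*n≢0 n (m * v) {{n≢0}}
      {{ℕ.m*n≢0⇒m≢0 (m * v) {{subst NonZero (sym mvl≡M) (IsOA.N≢0 oaA)}}}}

  balanced : (I : Subset (suc _)) → ∣ I ∣ ≡ t →
             ∃[ l ] NonZero l × (∀ β → multiplicity (stack A B) I β ≡ l)
  balanced (outside ∷ I) ∣I∣≡t
    with l  , l≢0 , bA ← IsOA.balanced oaA (outside ∷ I) ∣I∣≡t
       | l′ , _   , bB ← IsOA.balanced oaB (outside ∷ I) ∣I∣≡t =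
    l + l′ , m+n≢0 l l′ {{l≢0}} , λ β → trans
      (multiplicity-++ (map (reindex (_↑ˡ n)) A) _ (outside ∷ I) β)
      (cong₂ _+_
        (trans (multiplicity-reindex-outside (_↑ˡ n) I A β) (bA β))
        (trans (multiplicity-reindex-outside (m ↑ʳ_) I B β) (bB β)))
  balanced (inside ∷ I) ∣I∣≡t
    with l  , l≢0 , bA ← IsOA.balanced oaA (inside ∷ I) ∣I∣≡t
       | l′ , _   , bB ← IsOA.balanced oaB (inside ∷ I) ∣I∣≡t =
    l , l≢0 , λ { (y ∷ β) → trans
      (multiplicity-++ (map (reindex (_↑ˡ n)) A) _ (inside ∷ I) (y ∷ β))
      (at y β) }
    where
    -- A first level `y` can occur in only one block of the stack. `splitAt` finds the block, and
    -- rewriting by `eq` presents `y` as an injected level.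
    at : ∀ y β → multiplicity (map (reindex (_↑ˡ n)) A) (inside ∷ I) (y ∷ β)
               + multiplicity (map (reindex (m ↑ʳ_)) B) (inside ∷ I) (y ∷ β) ≡ l
    at y β with splitAt m y in eq
    ... | inj₁ x rewrite sym (Fin.splitAt⁻¹-↑ˡ {i = y} eq) = trans
      (cong₂ _+_
        (trans (multiplicity-reindex-image (_↑ˡ n) I (Fin.↑ˡ-injective n _ _) A x β) (bA (x ∷ β)))
        (multiplicity-reindex-∉image (m ↑ʳ_) I B β (λ z → ↑ˡ≢↑ʳ x z ∘ sym)))
      (ℕ.+-identityʳ l)
    -- Here the count is the index of `B`, which has to be traded for the index `l` of `A`.
    ... | inj₂ x rewrite sym (Fin.splitAt⁻¹-↑ʳ {i = y} eq) = cong₂ _+_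
      (multiplicity-reindex-∉image (_↑ˡ n) I A β (λ z → ↑ˡ≢↑ʳ z x))
      (trans (multiplicity-reindex-image (m ↑ʳ_) I (Fin.↑ʳ-injective m _ _) B x β)
             (trans (bB (x ∷ β)) (sym (indices-agree I bA bB))))

-- The first array as a nested subarray of the stack

widen : (s : Vec ℕ k) → Pointwise _≤_ (m ∷ s) ((m + n) ∷ s)
widen s = ℕ.m≤m+n _ _ ∷ Pointwise.refl ℕ.≤-refl

embed-refl : (α : Row s) → embed (Pointwise.refl ℕ.≤-refl) α ≡ α
embed-refl []      = refl
embed-refl (x ∷ α) = cong₂ _∷_ (Fin.inject≤-refl x _) (embed-refl α)

-- Nesting is phrased with `inject≤`, stacking with `↑ˡ`. Both preserve `toℕ`, so the embedded inner
-- array is the first block of the stack.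
embed-widen : (α : Row (m ∷ s)) → embed (widen {n = n} s) α ≡ reindex (_↑ˡ n) α
embed-widen {n = n} (x ∷ α) = cong₂ _∷_
  (Fin.toℕ-injective (trans (Fin.toℕ-inject≤ x _) (sym (Fin.toℕ-↑ˡ x n))))
  (embed-refl α)

-- A `subbag` is an injection between membership proofs, so it respects multiplicity. Membership in
-- a concatenation is a disjoint sum, and the left injection into it is injective.
xs⊆xs++ys : (xs ys : List X) → xs ∼[ subbag ] xs ++ ys
xs⊆xs++ys xs ys = ↔⇒↣ ++↔ ↣-∘ mk↣ inj₁-injective

stack-NOA : ∀ {M N} {s : Vec ℕ k} {A : List (Row (m ∷ s))} {B : List (Row (n ∷ s))} →
  M * n ≡ N * m → IsOA M (m ∷ s) t A → IsOA N (n ∷ s) t B → NOA (M + N) M (suc k) ((m + n) ∷ s) (m ∷ s) t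
stack-NOA {m = m} {n = n} {s = s} {A} {B} Mn≡Nm oaA oaB = record
  { R≤S         = widen s
  ; R<S         = zero , ℕ.m<m+n m (>-nonZero⁻¹ n {{All.head (IsOA.levels≢0 oaB)}})
  ; outer       = stack A B
  ; inner       = A
  ; outer-isOA  = stack-isOA Mn≡Nm oaA oaB
  ; inner-isOA  = oaA
  ; inner⊆outer = λ {α} → subst (_∼[ subbag ] stack A B)
                    (sym (List.map-cong embed-widen A)) (λ {α} → xs⊆xs++ys _ _ {α}) {α}
  }

-- The bound

-- Change of index along `g`. The operation is arbitrary so that the lemma serves both `∑` and `∏`;
-- comparing only `does` lets the two predicates live on different types.
foldr-filter-map : {P : Pred Y 0ℓ} {Q : Pred X 0ℓ} (P? : Decidable P) (Q? : Decidable Q)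
  {_∙_ : ℚ → ℚ → ℚ} {e : ℚ} {f : Y → ℚ} {g : X → Y} {h : X → ℚ} →
  (∀ x → does (P? (g x)) ≡ does (Q? x)) → (∀ x → f (g x) ≡ h x) → (xs : List X) →
  foldr _∙_ e (map f (filter P? (map g xs))) ≡ foldr _∙_ e (map h (filter Q? xs))
foldr-filter-map P? Q? P≗Q fg≗h []       = refl
foldr-filter-map P? Q? {_∙_} P≗Q fg≗h (x ∷ xs) rewrite P≗Q x with does (Q? x)
... | true  = cong₂ _∙_ (fg≗h x) (foldr-filter-map P? Q? P≗Q fg≗h xs)
... | false = foldr-filter-map P? Q? P≗Q fg≗h xs

∑-++ : (xs ys : List X) (f : X → ℚ) → ∑ (xs ++ ys) f ≡ ∑ xs f ℚ.+ ∑ ys f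
∑-++ []       ys f = sym (ℚ.+-identityˡ _)
∑-++ (x ∷ xs) ys f = trans (cong (f x ℚ.+_) (∑-++ xs ys f)) (sym (ℚ.+-assoc (f x) _ _))

∑-*ˡ : (c : ℚ) (xs : List X) (f : X → ℚ) → ∑ xs (λ x → c ℚ.* f x) ≡ c ℚ.* ∑ xs f
∑-*ˡ c []       f = sym (ℚ.*-zeroʳ c)
∑-*ˡ c (x ∷ xs) f = trans (cong (c ℚ.* f x ℚ.+_) (∑-*ˡ c xs f)) (sym (ℚ.*-distribˡ-+ c (f x) (∑ xs f)))

-- The general `g` is what the induction needs, since each step of `applyUpTo` replaces it by
-- `g ∘ suc`.
∑-applyUpTo-zero : (g : ℕ → ℕ) (f : ℕ → ℚ) → (∀ i → f (g i) ≡ 0ℚ) → ∀ m → ∑ (applyUpTo g m) f ≡ 0ℚ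
∑-applyUpTo-zero g f fg≡0 zero    = refl
∑-applyUpTo-zero g f fg≡0 (suc m) = cong₂ ℚ._+_ (fg≡0 0) (∑-applyUpTo-zero (g ∘ suc) f (fg≡0 ∘ suc) m)

-- Here `tabulate suc` is `allFin (suc n)` without its first element, and deciding whether `suc j`
-- lies in `b ∷ I` computes to deciding whether `j` lies in `I`.
∏-tail : ∀ (x : Fin (suc n) → ℚ) b (I : Subset n) →
  ∏ (filter (_∈? (b ∷ I)) (tabulate suc)) x ≡ ∏ (filter (_∈? I) (allFin n)) (x ∘ suc)
∏-tail {n} x b I = trans
  (cong (λ js → ∏ (filter (_∈? (b ∷ I)) js) x) (sym (List.map-tabulate {n = n} id suc)))
  (foldr-filter-map (_∈? (b ∷ I)) (_∈? I) (λ _ → refl) (λ _ → refl) (allFin n))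

∏-outside : (x : Fin (suc n) → ℚ) (I : Subset n) →
  ∏ (filter (_∈? (outside ∷ I)) (allFin (suc n))) x ≡ ∏ (filter (_∈? I) (allFin n)) (x ∘ suc)
∏-outside x I = ∏-tail x outside I

∏-inside : (x : Fin (suc n) → ℚ) (I : Subset n) →
  ∏ (filter (_∈? (inside ∷ I)) (allFin (suc n))) x ≡ x zero ℚ.* ∏ (filter (_∈? I) (allFin n)) (x ∘ suc)
∏-inside x I = cong (x zero ℚ.*_) (∏-tail x inside I)

-- Subsets are sorted by whether they contain the first index. The part containing it stays
-- unevaluated, because it is empty in degree 0 and lowers the degree otherwise.
∑∏-split : ∀ i (x : Fin (suc n) → ℚ) →
  let size? = λ (I : Subset (suc n)) → ∣ I ∣ ℕ.≟ i
      term  = λ I → ∏ (filter (_∈? I) (allFin (suc n))) x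
  in ∑∏ i x ≡ ∑∏ i (x ∘ suc) ℚ.+ ∑ (filter size? (map (inside ∷_) (subsets n))) term
∑∏-split {n} i x = begin
  ∑ (filter size? (map (outside ∷_) (subsets n) ++ map (inside ∷_) (subsets n))) term
    ≡⟨ cong (λ Is → ∑ Is term) (List.filter-++ size? (map (outside ∷_) (subsets n)) _) ⟩
  ∑ (filter size? (map (outside ∷_) (subsets n)) ++ filter size? (map (inside ∷_) (subsets n))) term
    ≡⟨ ∑-++ (filter size? (map (outside ∷_) (subsets n))) _ term ⟩
  ∑ (filter size? (map (outside ∷_) (subsets n))) term ℚ.+ ∑ (filter size? (map (inside ∷_) (subsets n))) term
    ≡⟨ cong (ℚ._+ ∑ (filter size? (map (inside ∷_) (subsets n))) term)
         (foldr-filter-map size? (λ I → ∣ I ∣ ℕ.≟ i) (λ _ → refl) (∏-outside x) (subsets n)) ⟩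
  ∑∏ i (x ∘ suc) ℚ.+ ∑ (filter size? (map (inside ∷_) (subsets n))) term ∎
  where
  open ≡-Reasoning
  size? = λ (I : Subset (suc n)) → ∣ I ∣ ℕ.≟ i
  term  = λ I → ∏ (filter (_∈? I) (allFin (suc n))) x

∑∏-zero : (x : Fin n → ℚ) → ∑∏ 0 x ≡ 1ℚ
∑∏-zero {zero}  x = refl
∑∏-zero {suc n} x = begin
  ∑∏ 0 x                 ≡⟨ ∑∏-split 0 x ⟩
  ∑∏ 0 (x ∘ suc) ℚ.+ ∑ (filter (λ I → ∣ I ∣ ℕ.≟ 0) (map (inside ∷_) (subsets n))) term
    -- A subset containing the first index cannot have size 0.
    ≡⟨ cong₂ ℚ._+_ (∑∏-zero (x ∘ suc))
         (cong (λ Is → ∑ Is term) (List.filter-none (λ (I : Subset (suc n)) → ∣ I ∣ ℕ.≟ 0)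
           (ListAll.map⁺ (ListAll.universal (λ _ ()) (subsets n))))) ⟩
  1ℚ                     ∎
  where
  open ≡-Reasoning
  term = λ I → ∏ (filter (_∈? I) (allFin (suc n))) x

-- The usual recurrence for elementary symmetric polynomials on removing the first variable.
∑∏-suc : ∀ i (x : Fin (suc n) → ℚ) →
  ∑∏ (suc i) x ≡ ∑∏ (suc i) (x ∘ suc) ℚ.+ x zero ℚ.* ∑∏ i (x ∘ suc)
∑∏-suc {n} i x = trans (∑∏-split (suc i) x) (cong (∑∏ (suc i) (x ∘ suc) ℚ.+_) (trans
  (foldr-filter-map (λ (I : Subset (suc n)) → ∣ I ∣ ℕ.≟ suc i) (λ I → ∣ I ∣ ℕ.≟ i)
    (λ _ → refl) (∏-inside x) (subsets n))
  (∑-*ˡ (x zero) (filter (λ I → ∣ I ∣ ℕ.≟ i) (subsets n)) _)))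

∑∏-vanish : ∀ i (x : Fin n → ℚ) → (∀ j → x j ≡ 0ℚ) → ∑∏ (suc i) x ≡ 0ℚ
∑∏-vanish {zero}  i x x≡0 = refl
∑∏-vanish {suc n} i x x≡0 = begin
  ∑∏ (suc i) x                                       ≡⟨ ∑∏-suc i x ⟩
  ∑∏ (suc i) (x ∘ suc) ℚ.+ x zero ℚ.* ∑∏ i (x ∘ suc)
    ≡⟨ cong₂ (λ p q → p ℚ.+ q ℚ.* ∑∏ i (x ∘ suc)) (∑∏-vanish i (x ∘ suc) (x≡0 ∘ suc)) (x≡0 zero) ⟩
  0ℚ ℚ.+ 0ℚ ℚ.* ∑∏ i (x ∘ suc)                       ≡⟨ ℚ.+-identityˡ _ ⟩
  0ℚ ℚ.* ∑∏ i (x ∘ suc)                              ≡⟨ ℚ.*-zeroˡ (∑∏ i (x ∘ suc)) ⟩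
  0ℚ                                                 ∎
  where open ≡-Reasoning

-- Symmetric sums when all variables after the first vanish

module _ (x : Fin (suc n) → ℚ) (x≡0 : ∀ j → x (suc j) ≡ 0ℚ) where

  open ≡-Reasoning

  ∑∏-one : ∑∏ 1 x ≡ x zero
  ∑∏-one = begin
    ∑∏ 1 x                                       ≡⟨ ∑∏-suc 0 x ⟩
    ∑∏ 1 (x ∘ suc) ℚ.+ x zero ℚ.* ∑∏ 0 (x ∘ suc)
      ≡⟨ cong₂ (λ p q → p ℚ.+ x zero ℚ.* q) (∑∏-vanish 0 (x ∘ suc) x≡0) (∑∏-zero (x ∘ suc)) ⟩
    0ℚ ℚ.+ x zero ℚ.* 1ℚ                         ≡⟨ ℚ.+-identityˡ _ ⟩
    x zero ℚ.* 1ℚ                                ≡⟨ ℚ.*-identityʳ (x zero) ⟩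
    x zero                                       ∎

  -- A subset of size at least 2 contains an index other than the first, so its product has a zero
  -- factor.
  ∑∏-2+ : ∀ i → ∑∏ (suc (suc i)) x ≡ 0ℚ
  ∑∏-2+ i = begin
    ∑∏ (suc (suc i)) x ≡⟨ ∑∏-suc (suc i) x ⟩
    ∑∏ (suc (suc i)) (x ∘ suc) ℚ.+ x zero ℚ.* ∑∏ (suc i) (x ∘ suc)
      ≡⟨ cong₂ (λ p q → p ℚ.+ x zero ℚ.* q) (∑∏-vanish (suc i) (x ∘ suc) x≡0) (∑∏-vanish i (x ∘ suc) x≡0) ⟩
    0ℚ ℚ.+ x zero ℚ.* 0ℚ ≡⟨ ℚ.+-identityˡ _ ⟩
    x zero ℚ.* 0ℚ        ≡⟨ ℚ.*-zeroʳ (x zero) ⟩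
    0ℚ                   ∎

  ∑∏-upTo : ∀ m → ∑ (upTo (suc (suc m))) (λ i → ∑∏ i x) ≡ 1ℚ ℚ.+ x zero
  ∑∏-upTo m = cong₂ ℚ._+_ (∑∏-zero x) (begin
    ∑∏ 1 x ℚ.+ ∑ (applyUpTo 2+ m) (λ i → ∑∏ i x)
      ≡⟨ cong₂ ℚ._+_ ∑∏-one (∑-applyUpTo-zero 2+ (λ i → ∑∏ i x) ∑∏-2+ m) ⟩
    x zero ℚ.+ 0ℚ ≡⟨ ℚ.+-identityʳ _ ⟩
    x zero        ∎)

  -- For t = 1 the main sum stops at degree 0, and `x zero` comes from the odd correction. For t at
  -- least 2 the main sum already reaches degree 1, and the odd correction vanishes.
  boundFactor-single : ∀ t → 1 ≤ t → boundFactor t x ≡ 1ℚ ℚ.+ x zero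
  boundFactor-single (suc zero)    _ = cong₂ ℚ._+_
    (trans (ℚ.+-identityʳ _) (∑∏-zero x))
    (trans (cong (x zero ℚ.*_) (∑∏-zero (x ∘ suc))) (ℚ.*-identityʳ (x zero)))
  -- Halving computes to `suc ⌊ t /2⌋`, so the correction involves a sum of positive degree in zero
  -- variables.
  boundFactor-single (suc (suc t)) _ with does (2 ∣? suc (suc t))
  ... | true  = ∑∏-upTo ⌊ t /2⌋
  ... | false = begin
    ∑ (upTo (suc (suc ⌊ t /2⌋))) (λ i → ∑∏ i x) ℚ.+ x zero ℚ.* ∑∏ (suc ⌊ t /2⌋) (x ∘ suc)
      ≡⟨ cong₂ (λ p q → p ℚ.+ x zero ℚ.* q) (∑∏-upTo ⌊ t /2⌋) (∑∏-vanish ⌊ t /2⌋ (x ∘ suc) x≡0) ⟩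
    1ℚ ℚ.+ x zero ℚ.+ x zero ℚ.* 0ℚ ≡⟨ cong (1ℚ ℚ.+ x zero ℚ.+_) (ℚ.*-zeroʳ (x zero)) ⟩
    1ℚ ℚ.+ x zero ℚ.+ 0ℚ            ≡⟨ ℚ.+-identityʳ _ ⟩
    1ℚ ℚ.+ x zero                   ∎

-- Ratios of levels and optimality of the stack

n/n≡1 : ∀ n .{{_ : NonZero n}} → + n / n ≡ 1ℚ
n/n≡1 (suc n) = ℚ.fromℚᵘ-cong {mkℚᵘ (+ suc n) n} {ℚᵘ.1ℚᵘ} (*≡* (ℤ.*-comm (+ suc n) (+ 1)))

-- Passing to unnormalised rationals avoids reduction to lowest terms and leaves a cross-multiplied
-- inequality of integers.
1≤[m+n]/m : ∀ m n .{{_ : NonZero m}} → 1ℚ ℚ.≤ + (m + n) / m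
1≤[m+n]/m (suc m) n = ℚ.toℚᵘ-cancel-≤ (ℚᵘ.≤-respʳ-≃
  (ℚᵘ.≃-sym (ℚ.toℚᵘ-fromℚᵘ (mkℚᵘ (+ (suc m + n)) m)))
  (*≤* (begin
    + 1 ℤ.* + suc m         ≡⟨ ℤ.*-identityˡ (+ suc m) ⟩
    + suc m                 ≤⟨ ℤ.+≤+ (ℕ.m≤m+n (suc m) n) ⟩
    + (suc m + n)           ≡⟨ ℤ.*-identityʳ (+ (suc m + n)) ⟨
    + (suc m + n) ℤ.* + 1   ∎)))
  where open ℤ.≤-Reasoning

-- Expanding, M (m + n) / m = M + M n / m, and M n = N m turns the last term into N.
M+N≡M*[m+n]/m : ∀ M N m n .{{_ : NonZero m}} → M * n ≡ N * m →
  + (M + N) / 1 ≡ (+ M / 1) ℚ.* (+ (m + n) / m)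
M+N≡M*[m+n]/m M N (suc m) n Mn≡Nm = ℚ.toℚᵘ-injective (begin
  toℚᵘ (+ (M + N) / 1)
    ≈⟨ ℚ.toℚᵘ-fromℚᵘ (mkℚᵘ (+ (M + N)) 0) ⟩
  mkℚᵘ (+ (M + N)) 0
    ≈⟨ *≡* cross ⟩
  mkℚᵘ (+ M) 0 ℚᵘ.* mkℚᵘ (+ (suc m + n)) m
    ≈⟨ ℚᵘ.*-cong (ℚ.toℚᵘ-fromℚᵘ (mkℚᵘ (+ M) 0)) (ℚ.toℚᵘ-fromℚᵘ (mkℚᵘ (+ (suc m + n)) m)) ⟨
  toℚᵘ (+ M / 1) ℚᵘ.* toℚᵘ (+ (suc m + n) / suc m)
    ≈⟨ ℚ.toℚᵘ-homo-* (+ M / 1) (+ (suc m + n) / suc m) ⟨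
  toℚᵘ ((+ M / 1) ℚ.* (+ (suc m + n) / suc m)) ∎)
  where
  open ℚᵘ.≃-Reasoning

  crossℕ : (M + N) * suc m ≡ M * (suc m + n)
  crossℕ = trans (ℕ.*-distribʳ-+ (suc m) M N)
    (trans (cong (_+_ (M * suc m)) (sym Mn≡Nm)) (sym (ℕ.*-distribˡ-+ M (suc m) n)))

  cross : + (M + N) ℤ.* + (1 * suc m) ≡ (+ M ℤ.* + (suc m + n)) ℤ.* + 1
  cross = trans (cong (λ d → + (M + N) ℤ.* + d) (ℕ.*-identityˡ (suc m)))
    (trans (sym (ℤ.pos-* (M + N) (suc m)))
    (trans (cong +_ crossℕ)
    (trans (ℤ.pos-* M (suc m + n)) (sym (ℤ.*-identityʳ _)))))

1+[p-1]≡p : ∀ p → 1ℚ ℚ.+ (p ℚ.- 1ℚ) ≡ p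
1+[p-1]≡p p = begin
  1ℚ ℚ.+ (p ℚ.- 1ℚ)      ≡⟨ ℚ.+-comm 1ℚ (p ℚ.- 1ℚ) ⟩
  -- After reassociation, the closed term `ℚ.- 1ℚ ℚ.+ 1ℚ` evaluates to `0ℚ`.
  p ℚ.- 1ℚ ℚ.+ 1ℚ        ≡⟨ ℚ.+-assoc p (ℚ.- 1ℚ) 1ℚ ⟩
  p ℚ.+ 0ℚ               ≡⟨ ℚ.+-identityʳ p ⟩
  p                      ∎
  where open ≡-Reasoning

-- The first ratio is (m + n)/m, at least 1, and all others equal 1. Hence the first is maximal and
-- the bound collapses to M times the first ratio.
stack-optimal : ∀ {M N} {s : Vec ℕ k} {A : List (Row (m ∷ s))} {B : List (Row (n ∷ s))}
  (Mn≡Nm : M * n ≡ N * m) (oaA : IsOA M (m ∷ s) t A) (oaB : IsOA N (n ∷ s) t B) →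
  Optimal (stack-NOA Mn≡Nm oaA oaB)
stack-optimal {m = m} {n = n} {t = t} {M} {N} {s} Mn≡Nm oaA oaB = record
  { first-max = λ where
      zero    → ℚ.≤-refl
      (suc j) → ℚ.≤-trans (ℚ.≤-reflexive (tail-ratio j)) (1≤[m+n]/m m n {{m≢0}})
  ; size      = begin
      + (M + N) / 1                      ≡⟨ M+N≡M*[m+n]/m M N m n {{m≢0}} Mn≡Nm ⟩
      (+ M / 1) ℚ.* ρ zero               ≡⟨ cong ((+ M / 1) ℚ.*_) (1+[p-1]≡p (ρ zero)) ⟨
      (+ M / 1) ℚ.* (1ℚ ℚ.+ (ρ zero ℚ.- 1ℚ))
        ≡⟨ cong ((+ M / 1) ℚ.*_)
             (boundFactor-single (λ j → ρ j ℚ.- 1ℚ) (λ j → cong (ℚ._- 1ℚ) (tail-ratio j)) t (IsOA.1≤t oaA)) ⟨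
      (+ M / 1) ℚ.* boundFactor t (λ j → ρ j ℚ.- 1ℚ) ∎
  }
  where
  open ≡-Reasoning

  R≢0 : All NonZero (m ∷ s)
  R≢0 = IsOA.levels≢0 oaA

  m≢0 : NonZero m
  m≢0 = All.head R≢0

  ρ : Fin (suc _) → ℚ
  ρ = ratio ((m + n) ∷ s) (m ∷ s) R≢0

  tail-ratio : ∀ j → ρ (suc j) ≡ 1ℚ
  tail-ratio j = n/n≡1 (lookup s j) {{All.lookup R≢0 (∈-lookup (suc j) (m ∷ s))}}

-- Clears denominators in the hypothesis on N₁/a₁ and N₂/b₁, giving the form in which stacking
-- consumes it.
/-injective : ∀ m n a b .{{_ : NonZero a}} .{{_ : NonZero b}} →
  + m / a ≡ + n / b → m * b ≡ n * a
/-injective m n (suc a) (suc b) = ℚ.normalize-injective-≃ m n (suc a) (suc b)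

theorem4p12 : (n t : ℕ) → 1 ≤ t → t ≤ suc n →
    (a₁ b₁ : ℕ) (s : Vec ℕ n) (N₁ N₂ : ℕ) →
    .{{_ : NonZero a₁}} → .{{_ : NonZero b₁}} → All NonZero s →
    .{{_ : NonZero N₁}} → .{{_ : NonZero N₂}} →
    + N₁ / a₁ ≡ + N₂ / b₁ →
    ∃ (IsOA N₁ (a₁ ∷ s) t) →
    ∃ (IsOA N₂ (b₁ ∷ s) t) →
    ∃ λ (P : NOA (N₁ + N₂) N₁ (suc n) ((a₁ + b₁) ∷ s) (a₁ ∷ s) t) → Optimal P
theorem4p12 n t _ _ a₁ b₁ s N₁ N₂ _ N₁/a₁≡N₂/b₁ (A , oaA) (B , oaB) =
  stack-NOA N₁b₁≡N₂a₁ oaA oaB , stack-optimal N₁b₁≡N₂a₁ oaA oaB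
  where
  N₁b₁≡N₂a₁ : N₁ * b₁ ≡ N₂ * a₁
  N₁b₁≡N₂a₁ = /-injective N₁ N₂ a₁ b₁ N₁/a₁≡N₂/b₁
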